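{- Let $\Xi_F=(S,\mathrm{wt})$ be a full passport with $|S|=N\ge 2$. Then the number of positive permutations of $\Xi_F$ is \[ |\mathbf{P}_+(\Xi_F)| = \sum_{\mathfrak{p}\in\mathfrak{P}(\Xi_F)} (-1)^{|\mathfrak{p}|-1} X(\mathfrak{p}). \]
   Context: A full passport $\Xi_F=(S,\mathrm{wt})$ consists of a finite set $S$ and a function $\mathrm{wt}:S\to\mathbb{R}\setminus\{0\}$ with $\sum_{s\in S}\mathrm{wt}(s)=0$; write $|\Xi_F|=|S|$. For a nonempty $S'\subseteq S$ with $\sum_{s\in S'}\mathrm{wt}(s)=0$, the subpassport $\Xi(S')$ is the full passport $(S',\mathrm{wt}|_{S'})$. A partition of $\Xi_F$ is a set $\mathfrak{p}=\{\Xi(S_1),\dots,\Xi(S_n)\}$ of subpassports such that $S=\bigsqcup_{i} S_i$ with each $S_i$ nonempty and of zero weight sum; its length is $|\mathfrak{p}|=n$, and $X(\mathfrak{p})=\prod_{i=1}^n(|S_i|-1)!$. $\mathfrak{P}(\Xi_F)$ is the set of all partitions of $\Xi_F$. A permutation of $\Xi_F$ is a sequence $(s_1,\dots,s_N)$ listing every element of $S$ exactly once; its cumulative sums are $H_0=0$ and $H_i=\sum_{j=1}^i\mathrm{wt}(s_j)$. The permutation is positive if $H_i>0$ for all $1\le i\le N-1$; $\mathbf{P}_+(\Xi_F)$ denotes the set of positive permutations. -}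

module Defs where

open import Data.Nat as ℕ using (ℕ; suc; _∸_)
open import Data.Nat using (_!)
open import Data.Integer as ℤ using (ℤ; +_)
open import Data.Fin using (Fin)
open import Data.List using (List; []; _∷_; [_]; map; concatMap; foldr; length; take; filter; allFin)
open import Data.List.Relation.Unary.All as All using (All; all?)
open import Relation.Binary.PropositionalEquality using (_≡_)
open import Relation.Binary.Definitions using (Trichotomous; Transitive; tri<; tri≈; tri>)
open import Relation.Nullary using (Dec; yes; no; ¬_)

-- Totally ordered abelian groups (the weights live in such a group;
-- the paper's setting ℝ is an instance).

record OrderedAbelianGroup : Set₁ where
  infixl 6 _+_
  infix 4 _<_
  field
    Carrier  : Set
    _+_      : Carrier → Carrier → Carrier
    ε        : Carrier
    -_       : Carrier → Carrier
    +-assoc  : ∀ x y z → (x + y) + z ≡ x + (y + z)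
    +-comm   : ∀ x y → x + y ≡ y + x
    +-identityʳ : ∀ x → x + ε ≡ x
    +-inverseʳ  : ∀ x → x + (- x) ≡ ε
    _<_      : Carrier → Carrier → Set
    <-trans  : Transitive _<_
    <-tri    : Trichotomous _≡_ _<_
    +-mono-< : ∀ {x y} z → x < y → x + z < y + z

  _<?_ : ∀ x y → Dec (x < y)
  x <? y with <-tri x y
  ... | tri< a _ _ = yes a
  ... | tri≈ ¬a _ _ = no ¬a
  ... | tri> ¬a _ _ = no ¬a

  _≟_ : ∀ x y → Dec (x ≡ y)
  x ≟ y with <-tri x y
  ... | tri< _ ¬b _ = no ¬b
  ... | tri≈ _ b _ = yes b
  ... | tri> _ ¬b _ = no ¬b

  sumG : List Carrier → Carrier
  sumG = foldr _+_ ε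

  prefixSums : Carrier → List Carrier → List Carrier
  prefixSums a []       = []
  prefixSums a (x ∷ xs) = (a + x) ∷ prefixSums (a + x) xs

insertAll : {A : Set} → A → List A → List (List A)
insertAll x []       = [ x ∷ [] ]
insertAll x (y ∷ ys) = (x ∷ y ∷ ys) ∷ map (y ∷_) (insertAll x ys)

-- all orderings of a list (each permutation listed exactly once when
-- the list has distinct entries)
perms : {A : Set} → List A → List (List A)
perms []       = [ [] ]
perms (x ∷ xs) = concatMap (insertAll x) (perms xs)

addToBlock : {A : Set} → A → List (List A) → List (List (List A))
addToBlock x []       = []
addToBlock x (b ∷ bs) = ((x ∷ b) ∷ bs) ∷ map (b ∷_) (addToBlock x bs)

-- all set partitions of a list (as lists of nonempty blocks); each set
-- partition occurs exactly once when the list has distinct entries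
setPartitions : {A : Set} → List A → List (List (List A))
setPartitions []       = [ [] ]
setPartitions (x ∷ xs) =
  concatMap (λ p → ((x ∷ []) ∷ p) ∷ addToBlock x p) (setPartitions xs)

-- Passports with underlying set S = Fin N and weights wt : Fin N → G

module _ (G : OrderedAbelianGroup) where
  open OrderedAbelianGroup G

  IsPositive : {N : ℕ} → (Fin N → Carrier) → List (Fin N) → Set
  IsPositive {N} wt σ = All (ε <_) (take (N ∸ 1) (prefixSums ε (map wt σ)))

  isPositive? : {N : ℕ} (wt : Fin N → Carrier) (σ : List (Fin N)) → Dec (IsPositive wt σ)
  isPositive? {N} wt σ = all? (ε <?_) (take (N ∸ 1) (prefixSums ε (map wt σ)))

  numPositivePerms : {N : ℕ} → (Fin N → Carrier) → ℕ
  numPositivePerms {N} wt = length (filter (isPositive? wt) (perms (allFin N)))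

  IsPassportPartition : {N : ℕ} → (Fin N → Carrier) → List (List (Fin N)) → Set
  IsPassportPartition wt p = All (λ b → sumG (map wt b) ≡ ε) p

  isPassportPartition? : {N : ℕ} (wt : Fin N → Carrier) (p : List (List (Fin N))) →
                         Dec (IsPassportPartition wt p)
  isPassportPartition? wt p = all? (λ b → sumG (map wt b) ≟ ε) p

  passportPartitions : {N : ℕ} → (Fin N → Carrier) → List (List (List (Fin N)))
  passportPartitions {N} wt = filter (isPassportPartition? wt) (setPartitions (allFin N))

X : {A : Set} → List (List A) → ℕ
X p = foldr (λ b r → ((length b ∸ 1) !) ℕ.* r) 1 p

signℤ : ℕ → ℤ
signℤ 0       = + 1
signℤ (suc k) = ℤ.- signℤ k

alternatingSum : {A : Set} → List (List (List A)) → ℤ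
alternatingSum ps = foldr (λ p r → signℤ (length p ∸ 1) ℤ.* (+ X p) ℤ.+ r) (+ 0) ps

{-# OPTIONS --safe #-}

-- Write F(S) for the number of positive orderings of a set S of total weight zero and C(S) for
-- the number (|S| − 1)! of its cyclic orderings, both being 0 for other sets and on ∅.
-- Rotating a cyclic ordering to a minimum of its cumulative sums makes it a cyclic sequence of
-- positive excursions, so C = − log (1 − F) as exponential generating functions, and the claim
-- is 1 − F = exp (− C).
-- Concretely, fix x in S. By a cycle lemma each cyclic ordering of S has exactly one rotation
-- that is nonnegative with x in its last excursion; splitting off the first excursion gives
--   C(S) = F(S) + Σ F(R) C(S ∖ R)   over nonempty R ⊆ S ∖ x,
-- which inverts the recurrence E(S) = − Σ C(B) E(S ∖ B), over B ∋ x, of the signed sum E over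
-- partitions, so that E(S) = − F(S) for nonempty S.
module Submission where

open import Defs
open import Data.Nat as ℕ using (ℕ; suc; _≤_; _∸_; _!; z≤n; s≤s)
open import Data.Nat.Properties using (≤-refl; ≤-trans; m≤n⇒m≤1+n)
import Data.Integer.Properties as ℤₚ
open import Data.Integer as ℤ using (ℤ; +_; 0ℤ; 1ℤ; -1ℤ)
open import Data.Integer.Tactic.RingSolver using (solve-∀)
open import Data.Bool using (Bool; true; false; not; _∧_)
open import Data.Empty using (⊥-elim)
open import Data.Fin using (Fin; zero; suc)
open import Data.List
  using (List; []; _∷_; _++_; map; concatMap; foldr; length; filter; take; allFin; tabulate)
open import Data.List.Properties using (length-tabulate)
open import Data.List.Relation.Unary.All as All using (All; []; _∷_; all?)
import Data.List.Relation.Unary.All.Properties as All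
open import Data.List.Relation.Binary.Permutation.Propositional
  using (_↭_; prep; swap; ↭-refl; ↭-trans)
open import Data.List.Relation.Binary.Permutation.Propositional.Properties using (↭-length)
open import Data.Product as Product using (_×_; _,_; map₁; map₂)
open import Function using (_∘_; id)
open import Level using (0ℓ)
open import Relation.Unary using (Pred; Decidable)
open import Relation.Nullary using (Dec; yes; no; does; ¬_)
open import Relation.Nullary.Decidable using (dec-true; dec-false)
open import Relation.Binary.Definitions using (Tri; tri<; tri≈; tri>)
open import Relation.Binary.PropositionalEquality
  using (_≡_; _≢_; refl; sym; trans; cong; cong₂; subst; subst₂; module ≡-Reasoning)
open ≡-Reasoning

-- Integer arithmetic

infixl 6 _+_
infixl 7 _*_

-- Opaque, so that unification can decompose sums and products.
opaque
  _+_ : ℤ → ℤ → ℤ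
  _+_ = ℤ._+_

  _*_ : ℤ → ℤ → ℤ
  _*_ = ℤ._*_

opaque
  unfolding _+_ _*_

  +-identityˡ : ∀ a → 0ℤ + a ≡ a
  +-identityˡ = ℤₚ.+-identityˡ

  +-identityʳ : ∀ a → a + 0ℤ ≡ a
  +-identityʳ = ℤₚ.+-identityʳ

  +-comm : ∀ a b → a + b ≡ b + a
  +-comm = ℤₚ.+-comm

  +-assoc : ∀ a b c → (a + b) + c ≡ a + (b + c)
  +-assoc = ℤₚ.+-assoc

  +-interchange : ∀ a b c d → (a + b) + (c + d) ≡ (a + c) + (b + d)
  +-interchange = solve-∀

  +-swapˡ : ∀ a b c → a + (b + c) ≡ b + (a + c)
  +-swapˡ = solve-∀

  *-zeroˡ : ∀ a → 0ℤ * a ≡ 0ℤ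
  *-zeroˡ = ℤₚ.*-zeroˡ

  *-zeroʳ : ∀ a → a * 0ℤ ≡ 0ℤ
  *-zeroʳ = ℤₚ.*-zeroʳ

  *-identityˡ : ∀ a → 1ℤ * a ≡ a
  *-identityˡ = ℤₚ.*-identityˡ

  *-identityʳ : ∀ a → a * 1ℤ ≡ a
  *-identityʳ = ℤₚ.*-identityʳ

  *-comm : ∀ a b → a * b ≡ b * a
  *-comm = ℤₚ.*-comm

  *-assoc : ∀ a b c → (a * b) * c ≡ a * (b * c)
  *-assoc = ℤₚ.*-assoc

  *-swapˡ : ∀ a b c → a * (b * c) ≡ b * (a * c)
  *-swapˡ = solve-∀

  *-distribˡ-+ : ∀ a b c → a * (b + c) ≡ a * b + a * c
  *-distribˡ-+ = ℤₚ.*-distribˡ-+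

  pos-suc : ∀ n → 1ℤ + + n ≡ + suc n
  pos-suc n = refl

  pos-* : ∀ m n → + (m ℕ.* n) ≡ + m * + n
  pos-* = ℤₚ.pos-*

+-congˡ : ∀ {a b c} → b ≡ c → a + b ≡ a + c
+-congˡ = cong (_+_ _)

+-congʳ : ∀ {a b c} → b ≡ c → b + a ≡ c + a
+-congʳ refl = refl

*-congˡ : ∀ {a b c} → b ≡ c → a * b ≡ a * c
*-congˡ = cong (_ *_)

*-congʳ : ∀ {a b c} → b ≡ c → b * a ≡ c * a
*-congʳ refl = refl

-- Finite sums over lists

private variable
  A B : Set

∑ : List A → (A → ℤ) → ℤ
∑ []       f = 0ℤ
∑ (x ∷ xs) f = f x + ∑ xs f

∑-cong : (l : List A) {f g : A → ℤ} → (∀ x → f x ≡ g x) → ∑ l f ≡ ∑ l g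
∑-cong []      eq = refl
∑-cong (x ∷ l) eq = cong₂ _+_ (eq x) (∑-cong l eq)

∑-congᴬ : {l : List A} {f g : A → ℤ} → All (λ x → f x ≡ g x) l → ∑ l f ≡ ∑ l g
∑-congᴬ []         = refl
∑-congᴬ (eq ∷ eqs) = cong₂ _+_ eq (∑-congᴬ eqs)

∑-map : (h : A → B) (l : List A) (f : B → ℤ) → ∑ (map h l) f ≡ ∑ l (f ∘ h)
∑-map h []      f = refl
∑-map h (x ∷ l) f = cong (_+_ (f (h x))) (∑-map h l f)

∑-++ : (k l : List A) (f : A → ℤ) → ∑ (k ++ l) f ≡ ∑ k f + ∑ l f
∑-++ []      l f = sym (+-identityˡ _)
∑-++ (x ∷ k) l f = trans (cong (_+_ (f x)) (∑-++ k l f)) (sym (+-assoc _ _ _))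

∑-concatMap : (h : A → List B) (l : List A) (f : B → ℤ) →
              ∑ (concatMap h l) f ≡ ∑ l (λ x → ∑ (h x) f)
∑-concatMap h []      f = refl
∑-concatMap h (x ∷ l) f =
  trans (∑-++ (h x) (concatMap h l) f) (cong (_+_ (∑ (h x) f)) (∑-concatMap h l f))

∑-+ : (l : List A) (f g : A → ℤ) → ∑ l (λ x → f x + g x) ≡ ∑ l f + ∑ l g
∑-+ []      f g = sym (+-identityˡ 0ℤ)
∑-+ (x ∷ l) f g = trans (+-congˡ (∑-+ l f g)) (+-interchange _ _ _ _)

∑-0 : (l : List A) → ∑ l (λ _ → 0ℤ) ≡ 0ℤ
∑-0 []      = refl
∑-0 (x ∷ l) = trans (+-identityˡ _) (∑-0 l)

∑-*ˡ : (c : ℤ) (l : List A) (f : A → ℤ) → ∑ l (λ x → c * f x) ≡ c * ∑ l f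
∑-*ˡ c []      f = sym (*-zeroʳ c)
∑-*ˡ c (x ∷ l) f = trans (cong (_+_ (c * f x)) (∑-*ˡ c l f)) (sym (*-distribˡ-+ c (f x) (∑ l f)))

∑-swap : (k : List A) (l : List B) (f : A → B → ℤ) →
         ∑ k (λ x → ∑ l (f x)) ≡ ∑ l (λ y → ∑ k (λ x → f x y))
∑-swap []      l f = sym (∑-0 l)
∑-swap (x ∷ k) l f = trans (cong (_+_ (∑ l (f x))) (∑-swap k l f)) (sym (∑-+ l (f x) _))

-- Cuts of words and splittings of sets

cuts : List A → List (List A × List A)
cuts []       = ([] , []) ∷ []
cuts (x ∷ xs) = ([] , x ∷ xs) ∷ map (map₁ (x ∷_)) (cuts xs)

-- The analogue of `cuts` for sets: complementary sublists instead of consecutive words. Sums over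
-- it are the convolution that multiplies exponential generating functions.
choices : List A → List (List A × List A)
choices []       = ([] , []) ∷ []
choices (x ∷ xs) = map (map₁ (x ∷_)) (choices xs) ++ map (map₂ (x ∷_)) (choices xs)

∑-cuts-∷ : (x : A) (w : List A) (φ : List A × List A → ℤ) →
           ∑ (cuts (x ∷ w)) φ ≡ φ ([] , x ∷ w) + ∑ (cuts w) (φ ∘ map₁ (x ∷_))
∑-cuts-∷ x w φ = +-congˡ (∑-map _ (cuts w) φ)

∑-choices-∷ : (x : A) (w : List A) (φ : List A × List A → ℤ) →
              ∑ (choices (x ∷ w)) φ ≡
              ∑ (choices w) (λ p → φ (map₁ (x ∷_) p) + φ (map₂ (x ∷_) p))
∑-choices-∷ x w φ = trans (∑-++ (map (map₁ (x ∷_)) (choices w)) _ φ)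
  (trans (cong₂ _+_ (∑-map _ (choices w) φ) (∑-map _ (choices w) φ))
         (sym (∑-+ (choices w) _ _)))

∑-insertAll-∷ : (x y : A) (w : List A) (f : List A → ℤ) →
                ∑ (insertAll x (y ∷ w)) f ≡ f (x ∷ y ∷ w) + ∑ (insertAll x w) (f ∘ (y ∷_))
∑-insertAll-∷ x y w f = +-congˡ (∑-map _ (insertAll x w) f)

∑-choices-swap : (w : List A) (φ : List A × List A → ℤ) →
                 ∑ (choices w) φ ≡ ∑ (choices w) (φ ∘ Product.swap)
∑-choices-swap []      φ = refl
∑-choices-swap (x ∷ w) φ =
  trans (∑-choices-∷ x w φ)
  (trans (∑-choices-swap w _)
  (trans (∑-cong (choices w) (λ p → +-comm (φ (map₁ (x ∷_) (Product.swap p))) _))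
         (sym (∑-choices-∷ x w (φ ∘ Product.swap)))))

choices-length : (w : List A) → All (λ (_ , r) → length r ≤ length w) (choices w)
choices-length []      = z≤n ∷ []
choices-length (x ∷ w) = All.++⁺
  (All.map⁺ (All.map m≤n⇒m≤1+n (choices-length w)))
  (All.map⁺ (All.map s≤s (choices-length w)))

∑-insertAll : (x : A) (w : List A) (f : List A → ℤ) →
              ∑ (insertAll x w) f ≡ ∑ (cuts w) (λ (a , b) → f (a ++ x ∷ b))
∑-insertAll x []      f = refl
∑-insertAll x (y ∷ w) f =
  trans (∑-insertAll-∷ x y w f)
  (trans (+-congˡ (∑-insertAll x w (f ∘ (y ∷_)))) (sym (∑-cuts-∷ y w _)))

-- Both sides run over the ways to cut `w` into three consecutive words.
∑-cuts-coassoc : (w : List A) (φ : List A → List A → List A → ℤ) →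
  ∑ (cuts w) (λ (u , c) → ∑ (cuts u) (λ (a , b) → φ a b c)) ≡
  ∑ (cuts w) (λ (a , v) → ∑ (cuts v) (λ (b , c) → φ a b c))
∑-cuts-coassoc []      φ = refl
∑-cuts-coassoc (x ∷ w) φ = begin
  ∑ (cuts (x ∷ w)) (λ (u , c) → ∑ (cuts u) (λ (a , b) → φ a b c))
    ≡⟨ ∑-cuts-∷ x w _ ⟩
  (φ [] [] (x ∷ w) + 0ℤ) + ∑ (cuts w) (λ (u , c) → ∑ (cuts (x ∷ u)) (λ (a , b) → φ a b c))
    ≡⟨ cong₂ _+_ (+-identityʳ _) (∑-cong (cuts w) (λ (u , c) → ∑-cuts-∷ x u _)) ⟩
  φ [] [] (x ∷ w) +
  ∑ (cuts w) (λ (u , c) → φ [] (x ∷ u) c + ∑ (cuts u) (λ (a , b) → φ (x ∷ a) b c))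
    ≡⟨ +-congˡ (∑-+ (cuts w) _ _) ⟩
  φ [] [] (x ∷ w) + (∑ (cuts w) (λ (u , c) → φ [] (x ∷ u) c) +
  ∑ (cuts w) (λ (u , c) → ∑ (cuts u) (λ (a , b) → φ (x ∷ a) b c)))
    ≡⟨ sym (+-assoc _ _ _) ⟩
  (φ [] [] (x ∷ w) + ∑ (cuts w) (λ (u , c) → φ [] (x ∷ u) c)) +
  ∑ (cuts w) (λ (u , c) → ∑ (cuts u) (λ (a , b) → φ (x ∷ a) b c))
    ≡⟨ cong₂ _+_ (sym (∑-cuts-∷ x w _)) (∑-cuts-coassoc w (λ a → φ (x ∷ a))) ⟩
  ∑ (cuts (x ∷ w)) (λ (b , c) → φ [] b c) +
  ∑ (cuts w) (λ (a , v) → ∑ (cuts v) (λ (b , c) → φ (x ∷ a) b c))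
    ≡⟨ sym (∑-cuts-∷ x w _) ⟩
  ∑ (cuts (x ∷ w)) (λ (a , v) → ∑ (cuts v) (λ (b , c) → φ a b c)) ∎

-- In a cut of a word containing the inserted `x`, this letter lies in the left or in the right
-- part, and deleting it leaves a cut of `w`.
∑-insertAll-cuts : (x : A) (w : List A) (φ : List A → List A → ℤ) →
  ∑ (insertAll x w) (λ τ → ∑ (cuts τ) (λ (u , v) → φ u v)) ≡
  ∑ (cuts w) (λ (u , v) → ∑ (insertAll x u) (λ a → φ a v) + ∑ (insertAll x v) (φ u))
∑-insertAll-cuts x []      φ = lemma (φ [] (x ∷ [])) (φ (x ∷ []) [])
  where
  opaque
    unfolding _+_
    lemma : ∀ a b → (a + (b + 0ℤ)) + 0ℤ ≡ ((b + 0ℤ) + (a + 0ℤ)) + 0ℤ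
    lemma = solve-∀
∑-insertAll-cuts x (y ∷ w) φ = begin
  ∑ (insertAll x (y ∷ w)) (λ τ → ∑ (cuts τ) (λ (u , v) → φ u v))
    ≡⟨ ∑-insertAll-∷ x y w _ ⟩
  ∑ (cuts (x ∷ y ∷ w)) (λ (u , v) → φ u v) +
  ∑ (insertAll x w) (λ τ → ∑ (cuts (y ∷ τ)) (λ (u , v) → φ u v))
    ≡⟨ cong₂ _+_
         (trans (∑-cuts-∷ x (y ∷ w) _) (+-congˡ (∑-cuts-∷ y w _)))
         (trans (∑-cong (insertAll x w) (λ τ → ∑-cuts-∷ y τ _))
         (trans (∑-+ (insertAll x w) _ _)
                (+-congˡ (∑-insertAll-cuts x w (λ u → φ (y ∷ u)))))) ⟩
  (p + (q + s)) + (t + ∑ (cuts w) (λ (u , v) → g u v))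
    -- `p`, `q` and `t` all belong to the empty cut of `y ∷ w`: the letter `x` enters the left part
    -- in `q` and the right part in `p` and `t`.
    ≡⟨ lemma p q s t _ ⟩
  ((q + 0ℤ) + (p + t)) + (s + ∑ (cuts w) (λ (u , v) → g u v))
    ≡⟨ cong₂ _+_ (cong (_+_ (q + 0ℤ)) (sym (∑-insertAll-∷ x y w (φ []))))
                 (sym (∑-+ (cuts w) _ _)) ⟩
  (∑ (insertAll x []) (λ a → φ a (y ∷ w)) + ∑ (insertAll x (y ∷ w)) (φ [])) +
  ∑ (cuts w) (λ (u , v) → φ (x ∷ y ∷ u) v + g u v)
    ≡⟨ +-congˡ (∑-cong (cuts w) (λ (u , v) →
         trans (sym (+-assoc _ _ _))
               (cong (_+ ∑ (insertAll x v) (φ (y ∷ u))) (sym (∑-insertAll-∷ x y u (λ a → φ a v)))))) ⟩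
  (∑ (insertAll x []) (λ a → φ a (y ∷ w)) + ∑ (insertAll x (y ∷ w)) (φ [])) +
  ∑ (cuts w) (λ (u , v) → ∑ (insertAll x (y ∷ u)) (λ a → φ a v) + ∑ (insertAll x v) (φ (y ∷ u)))
    ≡⟨ sym (∑-cuts-∷ y w _) ⟩
  ∑ (cuts (y ∷ w)) (λ (u , v) → ∑ (insertAll x u) (λ a → φ a v) + ∑ (insertAll x v) (φ u)) ∎
  where
  p = φ [] (x ∷ y ∷ w)
  q = φ (x ∷ []) (y ∷ w)
  s = ∑ (cuts w) (λ (u , v) → φ (x ∷ y ∷ u) v)
  t = ∑ (insertAll x w) (λ τ → φ [] (y ∷ τ))
  g : List _ → List _ → ℤ
  g u v = ∑ (insertAll x u) (λ a → φ (y ∷ a) v) + ∑ (insertAll x v) (φ (y ∷ u))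
  opaque
    unfolding _+_
    lemma : ∀ p q s t r → (p + (q + s)) + (t + r) ≡ ((q + 0ℤ) + (p + t)) + (s + r)
    lemma = solve-∀

-- Inserting `x` into the left or the right word of a cut corresponds to putting it into `B` or `R`,
-- so `∑-insertAll-cuts` matches the recursion of `choices`.
∑-perms-cuts : (S : List A) (φ : List A → List A → ℤ) →
  ∑ (perms S) (λ σ → ∑ (cuts σ) (λ (u , v) → φ u v)) ≡
  ∑ (choices S) (λ (B , R) → ∑ (perms B) (λ u → ∑ (perms R) (λ v → φ u v)))
∑-perms-cuts []      φ = sym (+-identityʳ _)
∑-perms-cuts (x ∷ S) φ = begin
  ∑ (perms (x ∷ S)) (λ σ → ∑ (cuts σ) (λ (u , v) → φ u v))
    ≡⟨ ∑-concatMap (insertAll x) (perms S) _ ⟩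
  ∑ (perms S) (λ w → ∑ (insertAll x w) (λ σ → ∑ (cuts σ) (λ (u , v) → φ u v)))
    ≡⟨ ∑-cong (perms S) (λ w → ∑-insertAll-cuts x w φ) ⟩
  ∑ (perms S) (λ w → ∑ (cuts w) (λ (u , v) →
    ∑ (insertAll x u) (λ a → φ a v) + ∑ (insertAll x v) (φ u)))
    ≡⟨ ∑-perms-cuts S _ ⟩
  ∑ (choices S) (λ (B , R) → ∑ (perms B) (λ u → ∑ (perms R) (λ v →
    ∑ (insertAll x u) (λ a → φ a v) + ∑ (insertAll x v) (φ u))))
    ≡⟨ ∑-cong (choices S) (λ (B , R) → split B R) ⟩
  ∑ (choices S) (λ (B , R) → h (x ∷ B) R + h B (x ∷ R))
    ≡⟨ sym (∑-choices-∷ x S _) ⟩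
  ∑ (choices (x ∷ S)) (λ (B , R) → h B R) ∎
  where
  h : List _ → List _ → ℤ
  h B R = ∑ (perms B) (λ u → ∑ (perms R) (λ v → φ u v))
  split : ∀ B R → ∑ (perms B) (λ u → ∑ (perms R) (λ v →
            ∑ (insertAll x u) (λ a → φ a v) + ∑ (insertAll x v) (φ u)))
          ≡ h (x ∷ B) R + h B (x ∷ R)
  split B R = begin
    ∑ (perms B) (λ u → ∑ (perms R) (λ v →
      ∑ (insertAll x u) (λ a → φ a v) + ∑ (insertAll x v) (φ u)))
      ≡⟨ ∑-cong (perms B) (λ u → ∑-+ (perms R) _ _) ⟩
    ∑ (perms B) (λ u → ∑ (perms R) (λ v → ∑ (insertAll x u) (λ a → φ a v)) +
                       ∑ (perms R) (λ v → ∑ (insertAll x v) (φ u)))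
      ≡⟨ ∑-+ (perms B) _ _ ⟩
    ∑ (perms B) (λ u → ∑ (perms R) (λ v → ∑ (insertAll x u) (λ a → φ a v))) +
    ∑ (perms B) (λ u → ∑ (perms R) (λ v → ∑ (insertAll x v) (φ u)))
      ≡⟨ cong₂ _+_
           (trans (∑-cong (perms B) (λ u → ∑-swap (perms R) (insertAll x u) _))
                  (sym (∑-concatMap (insertAll x) (perms B) _)))
           (∑-cong (perms B) (λ u → sym (∑-concatMap (insertAll x) (perms R) _))) ⟩
    h (x ∷ B) R + h B (x ∷ R) ∎

-- Exchanging the two words of a cut rotates the ordering. The totals agree because taking
-- complements only rearranges `choices S`.
∑-perms-cuts-swap : (S : List A) (φ : List A → List A → ℤ) →
  ∑ (perms S) (λ σ → ∑ (cuts σ) (λ (u , v) → φ u v)) ≡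
  ∑ (perms S) (λ σ → ∑ (cuts σ) (λ (u , v) → φ v u))
∑-perms-cuts-swap S φ =
  trans (∑-perms-cuts S φ)
  (trans (∑-choices-swap S _)
  (trans (∑-cong (choices S) (λ (B , R) → ∑-swap (perms R) (perms B) φ))
         (sym (∑-perms-cuts S (λ u v → φ v u)))))

-- Counting the orderings of a set

insertAll-↭ : (x : A) (w : List A) → All (_↭ x ∷ w) (insertAll x w)
insertAll-↭ x []      = ↭-refl ∷ []
insertAll-↭ x (y ∷ w) =
  ↭-refl ∷ All.map⁺ (All.map (λ p → ↭-trans (prep y p) (swap y x ↭-refl)) (insertAll-↭ x w))

perms-↭ : (S : List A) → All (_↭ S) (perms S)
perms-↭ []      = ↭-refl ∷ []
perms-↭ (x ∷ S) = All.concat⁺ (All.map⁺ (All.map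
  (λ {w} p → All.map (λ q → ↭-trans q (prep x p)) (insertAll-↭ x w)) (perms-↭ S)))

∑-insertAll-1 : (x : A) (w : List A) → ∑ (insertAll x w) (λ _ → 1ℤ) ≡ + suc (length w)
∑-insertAll-1 x []      = +-identityʳ 1ℤ
∑-insertAll-1 x (y ∷ w) = 
  trans (∑-insertAll-∷ x y w (λ _ → 1ℤ))
  (trans (+-congˡ (∑-insertAll-1 x w)) (pos-suc (suc (length w))))

-- The constant is arbitrary because the induction passes from `c` to the number of insertion
-- places, `suc (length S)`.
∑-perms-const : (S : List A) (c : ℤ) → ∑ (perms S) (λ _ → c) ≡ + (length S !) * c
∑-perms-const []      c = trans (+-identityʳ c) (sym (*-identityˡ c))
∑-perms-const (x ∷ S) c = begin
  ∑ (perms (x ∷ S)) (λ _ → c)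
    ≡⟨ ∑-concatMap (insertAll x) (perms S) _ ⟩
  ∑ (perms S) (λ w → ∑ (insertAll x w) (λ _ → c))
    ≡⟨ ∑-congᴬ (All.map (λ {w} → count w) (perms-↭ S)) ⟩
  ∑ (perms S) (λ _ → c * + suc (length S))
    ≡⟨ ∑-*ˡ c (perms S) (λ _ → + suc (length S)) ⟩
  c * ∑ (perms S) (λ _ → + suc (length S))
    ≡⟨ cong (c *_) (∑-perms-const S (+ suc (length S))) ⟩
  c * (+ (length S !) * + suc (length S))
    ≡⟨ trans (*-comm c _) (cong (_* c) (*-comm _ _)) ⟩
  (+ suc (length S) * + (length S !)) * c
    ≡⟨ cong (_* c) (sym (pos-* (suc (length S)) (length S !))) ⟩
  + (length (x ∷ S) !) * c ∎
  where
  count : ∀ w → w ↭ S → ∑ (insertAll x w) (λ _ → c) ≡ c * + suc (length S)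
  count w p = begin
    ∑ (insertAll x w) (λ _ → c)       ≡⟨ ∑-cong (insertAll x w) (λ _ → sym (*-identityʳ c)) ⟩
    ∑ (insertAll x w) (λ _ → c * 1ℤ)  ≡⟨ ∑-*ˡ c (insertAll x w) (λ _ → 1ℤ) ⟩
    c * ∑ (insertAll x w) (λ _ → 1ℤ)  ≡⟨ cong (c *_) (∑-insertAll-1 x w) ⟩
    c * + suc (length w)              ≡⟨ cong (λ n → c * + suc n) (↭-length p) ⟩
    c * + suc (length S)              ∎

-- Set partitions with a distinguished block

selections : List A → List (A × List A)
selections []       = []
selections (b ∷ bs) = (b , bs) ∷ map (map₂ (b ∷_)) (selections bs)

-- The pair with `[]` stands for a block still to be opened, so that adding an element to the
-- distinguished block also produces the new singletons.
pointings : List (List A) → List (List A × List (List A))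
pointings p = ([] , p) ∷ selections p

extend : A → List (List A) → List (List (List A))
extend x p = ((x ∷ []) ∷ p) ∷ addToBlock x p

∑-selections-∷ : (b : A) (bs : List A) (φ : A × List A → ℤ) →
  ∑ (selections (b ∷ bs)) φ ≡ φ (b , bs) + ∑ (selections bs) (φ ∘ map₂ (b ∷_))
∑-selections-∷ b bs φ = +-congˡ (∑-map _ (selections bs) φ)

∑-addToBlock-selections : (x : A) (p : List (List A)) (Φ : List A → List (List A) → ℤ) →
  ∑ (addToBlock x p) (λ q → ∑ (selections q) (λ (b , r) → Φ b r)) ≡
  ∑ (selections p) (λ (b , r) → Φ (x ∷ b) r + ∑ (addToBlock x r) (Φ b))
∑-addToBlock-selections x []       Φ = refl
∑-addToBlock-selections x (c ∷ cs) Φ = begin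
  ∑ (selections ((x ∷ c) ∷ cs)) (λ (b , r) → Φ b r) +
  ∑ (map (c ∷_) (addToBlock x cs)) (λ q → ∑ (selections q) (λ (b , r) → Φ b r))
    ≡⟨ cong₂ _+_ (∑-selections-∷ (x ∷ c) cs _)
         (trans (∑-map (c ∷_) (addToBlock x cs) _)
         (trans (∑-cong (addToBlock x cs) (λ q → ∑-selections-∷ c q _))
         (trans (∑-+ (addToBlock x cs) _ _)
                (+-congˡ (∑-addToBlock-selections x cs (λ b r → Φ b (c ∷ r))))))) ⟩
  (Φ (x ∷ c) cs + ∑ (selections cs) (λ (b , r) → Φ b ((x ∷ c) ∷ r))) +
  (∑ (addToBlock x cs) (Φ c) +
   ∑ (selections cs) (λ (b , r) → Φ (x ∷ b) (c ∷ r) + ∑ (addToBlock x r) (λ q → Φ b (c ∷ q))))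
    ≡⟨ +-interchange _ _ _ _ ⟩
  (Φ (x ∷ c) cs + ∑ (addToBlock x cs) (Φ c)) +
  (∑ (selections cs) (λ (b , r) → Φ b ((x ∷ c) ∷ r)) +
   ∑ (selections cs) (λ (b , r) → Φ (x ∷ b) (c ∷ r) + ∑ (addToBlock x r) (λ q → Φ b (c ∷ q))))
    ≡⟨ +-congˡ (trans (sym (∑-+ (selections cs) _ _))
         (∑-cong (selections cs) (λ (b , r) → trans (+-swapˡ _ _ _)
           (cong (λ z → Φ (x ∷ b) (c ∷ r) + (Φ b ((x ∷ c) ∷ r) + z))
                 (sym (∑-map (c ∷_) (addToBlock x r) (Φ b))))))) ⟩
  (Φ (x ∷ c) cs + ∑ (addToBlock x cs) (Φ c)) +
  ∑ (selections cs) (λ (b , r) → Φ (x ∷ b) (c ∷ r) + ∑ (addToBlock x (c ∷ r)) (Φ b))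
    ≡⟨ sym (∑-selections-∷ c cs _) ⟩
  ∑ (selections (c ∷ cs)) (λ (b , r) → Φ (x ∷ b) r + ∑ (addToBlock x r) (Φ b)) ∎

-- The new element either joins the distinguished block or extends the partition of the remaining
-- elements.
∑-extend-pointings : (x : A) (p : List (List A)) (Φ : List A → List (List A) → ℤ) →
  ∑ (extend x p) (λ q → ∑ (pointings q) (λ (b , r) → Φ b r)) ≡
  ∑ (pointings p) (λ (b , r) → Φ (x ∷ b) r + ∑ (extend x r) (Φ b))
∑-extend-pointings x p Φ = begin
  (Φ [] ((x ∷ []) ∷ p) + ∑ (selections ((x ∷ []) ∷ p)) (λ (b , r) → Φ b r)) +
  ∑ (addToBlock x p) (λ q → Φ [] q + ∑ (selections q) (λ (b , r) → Φ b r))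
    ≡⟨ cong₂ (λ s t → (Φ [] ((x ∷ []) ∷ p) + s) + t)
         (∑-selections-∷ (x ∷ []) p _)
         (trans (∑-+ (addToBlock x p) _ _) (+-congˡ (∑-addToBlock-selections x p Φ))) ⟩
  (Φ [] ((x ∷ []) ∷ p) + (Φ (x ∷ []) p + ∑ (selections p) (λ (b , r) → Φ b ((x ∷ []) ∷ r)))) +
  (∑ (addToBlock x p) (Φ []) +
   ∑ (selections p) (λ (b , r) → Φ (x ∷ b) r + ∑ (addToBlock x r) (Φ b)))
    ≡⟨ lemma _ _ _ _ _ ⟩
  (Φ (x ∷ []) p + (Φ [] ((x ∷ []) ∷ p) + ∑ (addToBlock x p) (Φ []))) +
  (∑ (selections p) (λ (b , r) → Φ b ((x ∷ []) ∷ r)) +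
   ∑ (selections p) (λ (b , r) → Φ (x ∷ b) r + ∑ (addToBlock x r) (Φ b)))
    ≡⟨ +-congˡ (trans (sym (∑-+ (selections p) _ _))
         (∑-cong (selections p) (λ (b , r) → +-swapˡ _ _ _))) ⟩
  ∑ (pointings p) (λ (b , r) → Φ (x ∷ b) r + ∑ (extend x r) (Φ b)) ∎
  where
  opaque
    unfolding _+_
    lemma : ∀ a b c d e → (a + (b + c)) + (d + e) ≡ (b + (a + d)) + (c + e)
    lemma = solve-∀

-- By `∑-extend-pointings` each new element makes the same two-way decision as in `choices`: into
-- the distinguished block `B` or into the rest `R`.
∑-setPartitions-pointings : (S : List A) (Φ : List A → List (List A) → ℤ) →
  ∑ (setPartitions S) (λ p → ∑ (pointings p) (λ (b , r) → Φ b r)) ≡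
  ∑ (choices S) (λ (B , R) → ∑ (setPartitions R) (Φ B))
∑-setPartitions-pointings []      Φ = refl
∑-setPartitions-pointings (x ∷ S) Φ = begin
  ∑ (setPartitions (x ∷ S)) (λ p → ∑ (pointings p) (λ (b , r) → Φ b r))
    ≡⟨ ∑-concatMap (extend x) (setPartitions S) _ ⟩
  ∑ (setPartitions S) (λ p → ∑ (extend x p) (λ q → ∑ (pointings q) (λ (b , r) → Φ b r)))
    ≡⟨ ∑-cong (setPartitions S) (λ p → ∑-extend-pointings x p Φ) ⟩
  ∑ (setPartitions S) (λ p → ∑ (pointings p) (λ (b , r) → Φ (x ∷ b) r + ∑ (extend x r) (Φ b)))
    ≡⟨ ∑-setPartitions-pointings S _ ⟩
  ∑ (choices S) (λ (B , R) →
    ∑ (setPartitions R) (λ r → Φ (x ∷ B) r + ∑ (extend x r) (Φ B)))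
    ≡⟨ ∑-cong (choices S) (λ (B , R) → trans (∑-+ (setPartitions R) _ _)
         (+-congˡ (sym (∑-concatMap (extend x) (setPartitions R) (Φ B))))) ⟩
  ∑ (choices S) (λ (B , R) → ∑ (setPartitions R) (Φ (x ∷ B)) + ∑ (setPartitions (x ∷ R)) (Φ B))
    ≡⟨ sym (∑-choices-∷ x S _) ⟩
  ∑ (choices (x ∷ S)) (λ (B , R) → ∑ (setPartitions R) (Φ B)) ∎

blockProduct : (List A → ℤ) → List (List A) → ℤ
blockProduct g = foldr (λ b r → g b * r) 1ℤ

∑-addToBlock-product : (g : List A → ℤ) (x : A) (p : List (List A)) →
  ∑ (addToBlock x p) (blockProduct g) ≡
  ∑ (selections p) (λ (b , r) → g (x ∷ b) * blockProduct g r)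
∑-addToBlock-product g x []       = refl
∑-addToBlock-product g x (c ∷ cs) = begin
  g (x ∷ c) * blockProduct g cs + ∑ (map (c ∷_) (addToBlock x cs)) (blockProduct g)
    ≡⟨ +-congˡ (trans (∑-map (c ∷_) (addToBlock x cs) _)
         (trans (∑-*ˡ (g c) (addToBlock x cs) (blockProduct g))
         (trans (cong (g c *_) (∑-addToBlock-product g x cs))
         (trans (sym (∑-*ˡ (g c) (selections cs) _))
                (∑-cong (selections cs) (λ _ → *-swapˡ _ _ _)))))) ⟩
  g (x ∷ c) * blockProduct g cs +
  ∑ (selections cs) (λ (b , r) → g (x ∷ b) * (g c * blockProduct g r))
    ≡⟨ sym (∑-selections-∷ c cs _) ⟩
  ∑ (selections (c ∷ cs)) (λ (b , r) → g (x ∷ b) * blockProduct g r) ∎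

-- Partitions are sorted by the block `x ∷ B` of the first element; the other blocks form an
-- arbitrary partition of the complement `R`.
∑-setPartitions-∷ : (g : List A → ℤ) (x : A) (S : List A) →
  ∑ (setPartitions (x ∷ S)) (blockProduct g) ≡
  ∑ (choices S) (λ (B , R) → g (x ∷ B) * ∑ (setPartitions R) (blockProduct g))
∑-setPartitions-∷ g x S = begin
  ∑ (setPartitions (x ∷ S)) (blockProduct g)
    ≡⟨ ∑-concatMap (extend x) (setPartitions S) _ ⟩
  ∑ (setPartitions S) (λ p → ∑ (extend x p) (blockProduct g))
    -- The head of `extend x p`, with its new singleton block, matches the pointing at `[]` by
    -- computation, so only `addToBlock` needs an argument.
    ≡⟨ ∑-cong (setPartitions S) (λ p → +-congˡ (∑-addToBlock-product g x p)) ⟩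
  ∑ (setPartitions S) (λ p → ∑ (pointings p) (λ (b , r) → g (x ∷ b) * blockProduct g r))
    ≡⟨ ∑-setPartitions-pointings S _ ⟩
  ∑ (choices S) (λ (B , R) → ∑ (setPartitions R) (λ r → g (x ∷ B) * blockProduct g r))
    ≡⟨ ∑-cong (choices S) (λ (B , R) → ∑-*ˡ (g (x ∷ B)) (setPartitions R) _) ⟩
  ∑ (choices S) (λ (B , R) → g (x ∷ B) * ∑ (setPartitions R) (blockProduct g)) ∎

-- Indicators, signs and the convolution unit

⟦_⟧ : Bool → ℤ
⟦ true  ⟧ = 1ℤ
⟦ false ⟧ = 0ℤ

⟦⟧-∧ : ∀ a b → ⟦ a ∧ b ⟧ ≡ ⟦ a ⟧ * ⟦ b ⟧
⟦⟧-∧ true  b = sym (*-identityˡ _)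
⟦⟧-∧ false b = sym (*-zeroˡ _)

⟦⟧-yes : {P : Set} (d : Dec P) → P → ⟦ does d ⟧ ≡ 1ℤ
⟦⟧-yes d p = cong ⟦_⟧ (dec-true d p)

⟦⟧-no : {P : Set} (d : Dec P) → ¬ P → ⟦ does d ⟧ ≡ 0ℤ
⟦⟧-no d ¬p = cong ⟦_⟧ (dec-false d ¬p)

∑-filter : {P : Pred A 0ℓ} (P? : Decidable P) (l : List A) (f : A → ℤ) →
           ∑ (filter P? l) f ≡ ∑ l (λ x → ⟦ does (P? x) ⟧ * f x)
∑-filter P? []      f = refl
∑-filter P? (x ∷ l) f with does (P? x)
... | true  = cong₂ _+_ (sym (*-identityˡ _)) (∑-filter P? l f)
... | false = trans (sym (+-identityˡ _)) (cong₂ _+_ (sym (*-zeroˡ _)) (∑-filter P? l f))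

opaque
  unfolding _+_ _*_

  alternatingSum-∑ : (ps : List (List (List A))) →
    alternatingSum ps ≡ ∑ ps (λ p → signℤ (length p ∸ 1) * + X p)
  alternatingSum-∑ []       = refl
  alternatingSum-∑ (p ∷ ps) = cong (_+_ (signℤ (length p ∸ 1) * + X p)) (alternatingSum-∑ ps)

  signℤ-suc : ∀ n → signℤ (suc n) ≡ -1ℤ * signℤ n
  signℤ-suc n = sym (ℤₚ.-1*i≡-i (signℤ n))

length-∑ : (l : List A) → + length l ≡ ∑ l (λ _ → 1ℤ)
length-∑ []      = refl
length-∑ (x ∷ l) = trans (sym (pos-suc (length l))) (+-congˡ (length-∑ l))

-- The set function with exponential generating function 1, hence the unit for convolution over
-- `choices`.
isEmpty : List A → ℤ
isEmpty []      = 1ℤ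
isEmpty (_ ∷ _) = 0ℤ

∑-choices-isEmpty : (S : List A) (g : List A → ℤ) →
                    ∑ (choices S) (λ (B , R) → g B * isEmpty R) ≡ g S
∑-choices-isEmpty []      g = trans (+-identityʳ _) (*-identityʳ _)
∑-choices-isEmpty (x ∷ S) g = begin
  ∑ (choices (x ∷ S)) (λ (B , R) → g B * isEmpty R)
    ≡⟨ ∑-choices-∷ x S _ ⟩
  ∑ (choices S) (λ (B , R) → g (x ∷ B) * isEmpty R + g B * 0ℤ)
    ≡⟨ ∑-cong (choices S) (λ _ → trans (+-congˡ (*-zeroʳ _)) (+-identityʳ _)) ⟩
  ∑ (choices S) (λ (B , R) → g (x ∷ B) * isEmpty R)
    ≡⟨ ∑-choices-isEmpty S (g ∘ (x ∷_)) ⟩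
  g (x ∷ S) ∎

addToBlock-nonempty : (x : A) (p : List (List A)) → All (_≢ []) (addToBlock x p)
addToBlock-nonempty x []       = []
addToBlock-nonempty x (b ∷ bs) = (λ ()) ∷ All.map⁺ (All.universal (λ _ ()) _)

setPartitions-nonempty : (x : A) (S : List A) → All (_≢ []) (setPartitions (x ∷ S))
setPartitions-nonempty x S = All.concat⁺ (All.map⁺
  (All.universal (λ p → (λ ()) ∷ addToBlock-nonempty x p) (setPartitions S)))

cuts-++ : (w : List A) → All (λ (a , b) → a ++ b ≡ w) (cuts w)
cuts-++ []      = refl ∷ []
cuts-++ (x ∷ w) = refl ∷ All.map⁺ (All.map (cong (x ∷_)) (cuts-++ w))

-- Weights and sign tests in the ordered group

module Walks (G : OrderedAbelianGroup) {A : Set} (wt : A → OrderedAbelianGroup.Carrier G) where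
  open OrderedAbelianGroup G
    using (Carrier; ε; _<_; <-trans; <-tri; +-mono-<; sumG; prefixSums)
    renaming (_+_ to _∙_; +-assoc to ∙-assoc; +-comm to ∙-comm; +-identityʳ to ∙-identityʳ;
              _<?_ to infix 4 _<?_; _≟_ to infix 4 _≟_)

  ∙-congʳ : ∀ {a b c} → b ≡ c → b ∙ a ≡ c ∙ a
  ∙-congʳ refl = refl

  ∙-identityˡ : ∀ c → ε ∙ c ≡ c
  ∙-identityˡ c = trans (∙-comm ε c) (∙-identityʳ c)

  weight : List A → Carrier
  weight b = sumG (map wt b)

  weight-++ : ∀ a b → weight (a ++ b) ≡ weight a ∙ weight b
  weight-++ []      b = sym (∙-identityˡ _)
  weight-++ (x ∷ a) b = trans (cong (wt x ∙_) (weight-++ a b)) (sym (∙-assoc _ _ _))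

  weight-↭ : ∀ {a b} → a ↭ b → weight a ≡ weight b
  weight-↭ _↭_.refl         = refl
  weight-↭ (prep x p)       = cong (wt x ∙_) (weight-↭ p)
  weight-↭ (swap x y p)     = trans (cong (λ t → wt x ∙ (wt y ∙ t)) (weight-↭ p))
    (trans (sym (∙-assoc _ _ _)) (trans (∙-congʳ (∙-comm _ _)) (∙-assoc _ _ _)))
  weight-↭ (_↭_.trans p q)  = trans (weight-↭ p) (weight-↭ q)

  isZero isPos isNeg isNonneg : Carrier → ℤ
  isZero   h = ⟦ does (h ≟ ε) ⟧
  isPos    h = ⟦ does (ε <? h) ⟧
  isNeg    h = ⟦ does (h <? ε) ⟧
  isNonneg h = ⟦ not (does (h <? ε)) ⟧

  <-irrefl : ∀ {x} → ¬ (x < x)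
  <-irrefl {x} p with <-tri x x
  ... | tri< _ ¬e _ = ¬e refl
  ... | tri≈ ¬p _ _ = ¬p p
  ... | tri> _ ¬e _ = ¬e refl

  <-asym : ∀ {x y} → x < y → ¬ (y < x)
  <-asym p q = <-irrefl (<-trans p q)

  ∙-monoʳ-< : ∀ {x y} z → x < y → z ∙ x < z ∙ y
  ∙-monoʳ-< z p = subst₂ _<_ (∙-comm _ z) (∙-comm _ z) (+-mono-< z p)

  isNonneg-neg : ∀ {h} → h < ε → isNonneg h ≡ 0ℤ
  isNonneg-neg {h} p = cong (⟦_⟧ ∘ not) (dec-true (h <? ε) p)

  isNonneg-nonneg : ∀ {h} → ¬ (h < ε) → isNonneg h ≡ 1ℤ
  isNonneg-nonneg {h} p = cong (⟦_⟧ ∘ not) (dec-false (h <? ε) p)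

  isNonneg-ε : isNonneg ε ≡ 1ℤ
  isNonneg-ε = isNonneg-nonneg <-irrefl

  -- A nonnegative height is positive or zero. In the zero case `h` is replaced by `ε` and the
  -- factor `isNonneg ε` kept, so that the term has the shape of a walk restarted at `ε`.
  isNonneg-split : ∀ h (t : Carrier → ℤ) c →
    isNonneg h * t (h ∙ c) ≡ isPos h * t (h ∙ c) + isZero h * (isNonneg ε * t (ε ∙ c))
  isNonneg-split h t c with <-tri h ε
  ... | tri< p ¬e _
    rewrite ⟦⟧-no (ε <? h) (<-asym p)
    = trans (sym (+-identityʳ _)) (+-congˡ (sym (*-zeroˡ _)))
  ... | tri≈ _ refl _
    rewrite ⟦⟧-no (ε <? ε) <-irrefl | isNonneg-ε
    = trans (sym (+-identityˡ _)) (cong₂ _+_ (sym (*-zeroˡ _)) (sym (*-identityˡ _)))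
  ... | tri> _ ¬e p
    rewrite ⟦⟧-yes (ε <? h) p
    = trans (sym (+-identityʳ _)) (+-congˡ (sym (*-zeroˡ _)))

  -- Walks and their excursions

  -- Indicator that the walk from h along ys stays positive until it ends at ε.
  descent : Carrier → List A → ℤ
  descent h []       = isZero h
  descent h (y ∷ ys) = isPos h * descent (h ∙ wt y) ys

  -- The initial height `ε` is not tested for positivity, and the value on the empty word encodes
  -- F(∅) = 0.
  excursion : List A → ℤ
  excursion []       = 0ℤ
  excursion (y ∷ ys) = descent (wt y) ys

  -- Indicator that the walk from h along a ++ x ∷ b stays nonnegative, ends at ε, and
  -- does not visit ε in between after the step x.
  lastExcursion : Carrier → List A → A → List A → ℤ
  lastExcursion h []      x b = isNonneg h * descent (h ∙ wt x) b
  lastExcursion h (y ∷ a) x b = isNonneg h * lastExcursion (h ∙ wt y) a x b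

  -- Decomposition at the first visit to `ε`. A visit before the end can occur only before the step
  -- `x`, so only `a` is cut; after the visit the walk starts afresh from `ε`.
  lastExcursion-descent : ∀ h a x b → lastExcursion h a x b ≡
    descent h (a ++ x ∷ b) + ∑ (cuts a) (λ (a₁ , a₂) → descent h a₁ * lastExcursion ε a₂ x b)
  lastExcursion-descent h []      x b =
    trans (isNonneg-split h (λ c → descent c b) (wt x)) (+-congˡ (sym (+-identityʳ _)))
  lastExcursion-descent h (y ∷ a) x b = begin
    isNonneg h * lastExcursion (h ∙ wt y) a x b
      ≡⟨ isNonneg-split h (λ c → lastExcursion c a x b) (wt y) ⟩
    isPos h * lastExcursion (h ∙ wt y) a x b + isZero h * lastExcursion ε (y ∷ a) x b
      ≡⟨ +-congʳ (trans (cong (isPos h *_) (lastExcursion-descent (h ∙ wt y) a x b))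
                            (*-distribˡ-+ _ _ _)) ⟩
    (descent h (y ∷ a ++ x ∷ b) +
     isPos h * ∑ (cuts a) (λ (a₁ , a₂) → descent (h ∙ wt y) a₁ * lastExcursion ε a₂ x b)) +
    isZero h * lastExcursion ε (y ∷ a) x b
      ≡⟨ trans (+-assoc _ _ _) (+-congˡ (+-comm _ _)) ⟩
    descent h (y ∷ a ++ x ∷ b) + (isZero h * lastExcursion ε (y ∷ a) x b +
     isPos h * ∑ (cuts a) (λ (a₁ , a₂) → descent (h ∙ wt y) a₁ * lastExcursion ε a₂ x b))
      ≡⟨ cong (λ t → descent h (y ∷ a ++ x ∷ b) + (isZero h * lastExcursion ε (y ∷ a) x b + t))
           (trans (sym (∑-*ˡ (isPos h) (cuts a) _))
                  (∑-cong (cuts a) (λ _ → sym (*-assoc _ _ _)))) ⟩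
    descent h (y ∷ a ++ x ∷ b) + (isZero h * lastExcursion ε (y ∷ a) x b +
     ∑ (cuts a) (λ (a₁ , a₂) → descent h (y ∷ a₁) * lastExcursion ε a₂ x b))
      ≡⟨ +-congˡ (sym (∑-cuts-∷ y a _)) ⟩
    descent h (y ∷ a ++ x ∷ b) +
    ∑ (cuts (y ∷ a)) (λ (a₁ , a₂) → descent h a₁ * lastExcursion ε a₂ x b) ∎

  -- The same decomposition, applied after the first step so that the start at `ε` does not count as
  -- a return. The cut with empty first word contributes nothing, as `excursion []` is 0.
  lastExcursion-excursion : ∀ a x b → lastExcursion ε a x b ≡
    excursion (a ++ x ∷ b) + ∑ (cuts a) (λ (a₁ , a₂) → excursion a₁ * lastExcursion ε a₂ x b)
  lastExcursion-excursion []      x b = begin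
    isNonneg ε * descent (ε ∙ wt x) b
      ≡⟨ trans (cong₂ _*_ isNonneg-ε (cong (λ c → descent c b) (∙-identityˡ (wt x))))
               (*-identityˡ _) ⟩
    excursion (x ∷ b)
      ≡⟨ sym (trans (+-congˡ (trans (+-identityʳ _) (*-zeroˡ _))) (+-identityʳ _)) ⟩
    excursion (x ∷ b) + ∑ (cuts []) (λ (a₁ , a₂) → excursion a₁ * lastExcursion ε a₂ x b) ∎
  lastExcursion-excursion (y ∷ a) x b = begin
    isNonneg ε * lastExcursion (ε ∙ wt y) a x b
      ≡⟨ trans (cong₂ _*_ isNonneg-ε (cong (λ c → lastExcursion c a x b) (∙-identityˡ (wt y))))
               (*-identityˡ _) ⟩
    lastExcursion (wt y) a x b
      ≡⟨ lastExcursion-descent (wt y) a x b ⟩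
    excursion (y ∷ a ++ x ∷ b) +
    ∑ (cuts a) (λ (a₁ , a₂) → excursion (y ∷ a₁) * lastExcursion ε a₂ x b)
      ≡⟨ +-congˡ (sym (trans (∑-cuts-∷ y a _)
           (trans (+-congʳ (*-zeroˡ _)) (+-identityˡ _)))) ⟩
    excursion (y ∷ a ++ x ∷ b) +
    ∑ (cuts (y ∷ a)) (λ (a₁ , a₂) → excursion a₁ * lastExcursion ε a₂ x b) ∎

  -- Minima of walks and the cycle lemma

  prefixesNonneg : Carrier → List A → ℤ
  prefixesNonneg h []      = isNonneg h
  prefixesNonneg h (y ∷ b) = isNonneg h * prefixesNonneg (h ∙ wt y) b

  suffixesNeg : List A → ℤ
  suffixesNeg []      = 1ℤ
  suffixesNeg (y ∷ a) = isNeg (weight (y ∷ a)) * suffixesNeg a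

  isPos-isNeg : ∀ c t → isPos c * isZero (c ∙ t) ≡ isZero (c ∙ t) * isNeg t
  isPos-isNeg c t with c ∙ t ≟ ε
  ... | no _  = trans (*-zeroʳ _) (sym (*-zeroˡ _))
  ... | yes e = trans (*-identityʳ _) (trans (pos≡neg (ε <? c)) (sym (*-identityˡ _)))
    where
    pos≡neg : (d : Dec (ε < c)) → ⟦ does d ⟧ ≡ isNeg t
    pos≡neg (yes p) = sym (⟦⟧-yes (t <? ε)
      (subst (_< ε) (∙-identityˡ t) (subst (ε ∙ t <_) e (+-mono-< t p))))
    pos≡neg (no ¬p) = sym (⟦⟧-no (t <? ε)
      (λ q → ¬p (subst (ε <_) (∙-identityʳ c) (subst (_< c ∙ ε) e (∙-monoʳ-< c q)))))

  -- On a walk that ends at `ε`, a height is positive exactly when the weight still to come is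
  -- negative. This trades conditions on heights for conditions that do not mention the start.
  descent-suffixesNeg : ∀ c a → descent c a ≡ isZero (c ∙ weight a) * suffixesNeg a
  descent-suffixesNeg c []      = sym (trans (*-identityʳ _) (cong isZero (∙-identityʳ c)))
  descent-suffixesNeg c (y ∷ a) = begin
    isPos c * descent (c ∙ wt y) a
      ≡⟨ cong (isPos c *_) (descent-suffixesNeg (c ∙ wt y) a) ⟩
    isPos c * (isZero ((c ∙ wt y) ∙ weight a) * suffixesNeg a)
      ≡⟨ cong (λ t → isPos c * (isZero t * suffixesNeg a)) (∙-assoc _ _ _) ⟩
    isPos c * (isZero (c ∙ weight (y ∷ a)) * suffixesNeg a)
      ≡⟨ trans (sym (*-assoc _ _ _)) (trans (cong (_* suffixesNeg a) (isPos-isNeg c _))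
               (*-assoc _ _ _)) ⟩
    isZero (c ∙ weight (y ∷ a)) * suffixesNeg (y ∷ a) ∎

  -- Here `b` precedes `x` and `a` follows it, as in a rotation of the cyclic word `x ∷ a ++ b`. At
  -- `h = ε` only the total weight couples the two words, and all rotations share it.
  lastExcursion-factor : ∀ h b x a → lastExcursion h b x a ≡
    isZero ((h ∙ weight b) ∙ weight (x ∷ a)) * (prefixesNonneg h b * suffixesNeg a)
  lastExcursion-factor h []      x a = begin
    isNonneg h * descent (h ∙ wt x) a
      ≡⟨ cong (isNonneg h *_) (descent-suffixesNeg (h ∙ wt x) a) ⟩
    isNonneg h * (isZero ((h ∙ wt x) ∙ weight a) * suffixesNeg a)
      ≡⟨ *-swapˡ _ _ _ ⟩
    isZero ((h ∙ wt x) ∙ weight a) * (isNonneg h * suffixesNeg a)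
      ≡⟨ cong (λ t → isZero t * (isNonneg h * suffixesNeg a))
           (trans (∙-assoc _ _ _) (cong (_∙ weight (x ∷ a)) (sym (∙-identityʳ h)))) ⟩
    isZero ((h ∙ ε) ∙ weight (x ∷ a)) * (isNonneg h * suffixesNeg a) ∎
  lastExcursion-factor h (y ∷ b) x a = begin
    isNonneg h * lastExcursion (h ∙ wt y) b x a
      ≡⟨ cong (isNonneg h *_) (lastExcursion-factor (h ∙ wt y) b x a) ⟩
    isNonneg h * (isZero (((h ∙ wt y) ∙ weight b) ∙ weight (x ∷ a)) *
                  (prefixesNonneg (h ∙ wt y) b * suffixesNeg a))
      ≡⟨ trans (*-swapˡ _ _ _) (*-congˡ (sym (*-assoc _ _ _))) ⟩
    isZero (((h ∙ wt y) ∙ weight b) ∙ weight (x ∷ a)) *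
    (prefixesNonneg h (y ∷ b) * suffixesNeg a)
      ≡⟨ cong (λ t → isZero (t ∙ weight (x ∷ a)) * (prefixesNonneg h (y ∷ b) * suffixesNeg a))
           (∙-assoc _ _ _) ⟩
    isZero ((h ∙ weight (y ∷ b)) ∙ weight (x ∷ a)) *
    (prefixesNonneg h (y ∷ b) * suffixesNeg a) ∎

  prefixesNonneg-ε-∷ : ∀ y w → prefixesNonneg ε (y ∷ w) ≡ prefixesNonneg (wt y) w
  prefixesNonneg-ε-∷ y w =
    trans (cong₂ _*_ isNonneg-ε (cong (λ c → prefixesNonneg c w) (∙-identityˡ (wt y))))
          (*-identityˡ _)

  isNeg-neg-∙ : ∀ c t → c < ε → isNeg (c ∙ t) * isNeg t ≡ isNeg t
  isNeg-neg-∙ c t c<ε with t <? ε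
  ... | no _  = *-zeroʳ _
  ... | yes p = trans (*-identityʳ _)
    (⟦⟧-yes (c ∙ t <? ε) (<-trans (subst (c ∙ t <_) (∙-identityˡ t) (+-mono-< t c<ε)) p))

  isNeg-nonneg-∙ : ∀ c t → ¬ (c < ε) → isNeg (c ∙ t) * isNeg t ≡ isNeg (c ∙ t)
  isNeg-nonneg-∙ c t c≮ε with c ∙ t <? ε
  ... | no _  = *-zeroˡ _
  ... | yes p = trans (*-identityˡ _) (⟦⟧-yes (t <? ε) (t<ε (<-tri c ε)))
    where
    t<ε : Tri (c < ε) (c ≡ ε) (ε < c) → t < ε
    t<ε (tri< q _ _)    = ⊥-elim (c≮ε q)
    t<ε (tri≈ _ refl _) = subst (_< ε) (∙-identityˡ t) p
    t<ε (tri> _ _ q)    = <-trans (subst (_< c ∙ t) (∙-identityˡ t) (+-mono-< t q)) p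

  -- If the walk from c along w visits a negative height, exactly one cut of w satisfies
  -- the three conditions: the one at the first minimum.
  negative-minimum : ∀ c w →
    ∑ (cuts w) (λ (a , b) → isNeg (c ∙ weight a) * (suffixesNeg a * prefixesNonneg ε b)) +
    prefixesNonneg c w ≡ 1ℤ
  negative-minimum c []
    rewrite ∙-identityʳ c | isNonneg-ε | *-identityʳ 1ℤ with c <? ε
  ... | yes _ = trans (+-identityʳ _) (trans (+-identityʳ _) (*-identityʳ _))
  ... | no _  = trans (cong (_+ 1ℤ) (trans (+-identityʳ _) (*-zeroˡ _))) (+-identityˡ _)
  negative-minimum c (y ∷ w) = trans (+-congʳ (∑-cuts-∷ y w _)) (go (c <? ε))
    where
    -- In both cases below the two sign tests on `y ∷ a` merge into one test on `a` from a new
    -- starting height `c′`.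
    tail : ∀ {c′} →
      (∀ t → isNeg (c ∙ (wt y ∙ t)) * isNeg (wt y ∙ t) ≡ isNeg (c′ ∙ t)) →
      ∑ (cuts w) (λ (a , b) →
        isNeg (c ∙ weight (y ∷ a)) * (suffixesNeg (y ∷ a) * prefixesNonneg ε b)) ≡
      ∑ (cuts w) (λ (a , b) → isNeg (c′ ∙ weight a) * (suffixesNeg a * prefixesNonneg ε b))
    tail eq = ∑-cong (cuts w) (λ (a , b) →
      trans (*-congˡ (*-assoc _ _ _)) (trans (sym (*-assoc _ _ _)) (*-congʳ (eq (weight a)))))
    go : Dec (c < ε) →
      ((isNeg (c ∙ ε) * (1ℤ * prefixesNonneg ε (y ∷ w)) +
        ∑ (cuts w) (λ (a , b) →
          isNeg (c ∙ weight (y ∷ a)) * (suffixesNeg (y ∷ a) * prefixesNonneg ε b))) +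
       prefixesNonneg c (y ∷ w)) ≡ 1ℤ
    -- For negative `c`, the suffix test on `y ∷ a` implies the height test. What remains is the
    -- claim for the walk from `wt y`, where the empty cut supplies the nonnegative term.
    go (yes c<ε)
      rewrite ∙-identityʳ c | ⟦⟧-yes (c <? ε) c<ε | isNonneg-neg c<ε
            | prefixesNonneg-ε-∷ y w
            | tail {wt y} (λ t → isNeg-neg-∙ c (wt y ∙ t) c<ε)
      = trans (cong₂ _+_ (+-congʳ (trans (*-identityˡ _) (*-identityˡ _))) (*-zeroˡ _))
        (trans (+-identityʳ _) (trans (+-comm _ _) (negative-minimum (wt y) w)))
    -- For nonnegative `c` the empty cut fails, and the height test on `y ∷ a` implies the suffix
    -- test, so the walk simply moves on to `c ∙ wt y`.
    go (no c≮ε)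
      rewrite ∙-identityʳ c | ⟦⟧-no (c <? ε) c≮ε | isNonneg-nonneg c≮ε
            | tail {c ∙ wt y} (λ t →
                trans (isNeg-nonneg-∙ c (wt y ∙ t) c≮ε) (cong isNeg (sym (∙-assoc _ _ _))))
      = trans (cong₂ _+_ (trans (+-congʳ (*-zeroˡ _)) (+-identityˡ _)) (*-identityˡ _))
              (negative-minimum (c ∙ wt y) w)

  -- Again the cut is at the first minimum. The empty cut accounts for walks that never go below
  -- their start; `negative-minimum` from `wt y` accounts for the others.
  unique-minimum : ∀ w → ∑ (cuts w) (λ (a , b) → suffixesNeg a * prefixesNonneg ε b) ≡ 1ℤ
  unique-minimum []      = trans (+-identityʳ _) (trans (*-identityˡ _) isNonneg-ε)
  unique-minimum (y ∷ w) = trans (∑-cuts-∷ y w _)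
    (trans (cong₂ _+_ (trans (*-identityˡ _) (prefixesNonneg-ε-∷ y w))
                      (∑-cong (cuts w) (λ _ → *-assoc _ _ _)))
    (trans (+-comm _ _) (negative-minimum (wt y) w)))

  -- Among the rotations of the cyclic word x ∷ w exactly one is nonnegative with x in its
  -- last excursion.
  cycle-lemma : ∀ x w →
    ∑ (cuts w) (λ (a , b) → lastExcursion ε b x a) ≡ isZero (weight (x ∷ w))
  cycle-lemma x w = begin
    ∑ (cuts w) (λ (a , b) → lastExcursion ε b x a)
      ≡⟨ ∑-cong (cuts w) (λ (a , b) → lastExcursion-factor ε b x a) ⟩
    ∑ (cuts w) (λ (a , b) →
      isZero ((ε ∙ weight b) ∙ weight (x ∷ a)) * (prefixesNonneg ε b * suffixesNeg a))
      ≡⟨ ∑-congᴬ (All.map (λ {(a , b)} e →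
           cong₂ _*_ (cong isZero (total a b e)) (*-comm _ _)) (cuts-++ w)) ⟩
    ∑ (cuts w) (λ (a , b) →
      isZero (weight (x ∷ w)) * (suffixesNeg a * prefixesNonneg ε b))
      ≡⟨ ∑-*ˡ (isZero (weight (x ∷ w))) (cuts w) _ ⟩
    isZero (weight (x ∷ w)) * ∑ (cuts w) (λ (a , b) → suffixesNeg a * prefixesNonneg ε b)
      ≡⟨ trans (*-congˡ (unique-minimum w)) (*-identityʳ _) ⟩
    isZero (weight (x ∷ w)) ∎
    where
    total : ∀ a b → a ++ b ≡ w → (ε ∙ weight b) ∙ weight (x ∷ a) ≡ weight (x ∷ w)
    total a b refl = trans (∙-congʳ (∙-identityˡ _))
      (trans (∙-comm _ _) (trans (∙-assoc _ _ _) (cong (wt x ∙_) (sym (weight-++ a b)))))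

  -- Counting cyclic orderings by excursions

  -- C(b), except on the empty block, where it is 1.
  cyclicCount : List A → ℤ
  cyclicCount b = isZero (weight b) * + ((length b ∸ 1) !)

  excursionCount : List A → ℤ
  excursionCount S = ∑ (perms S) excursion

  lastExcursionCount : A → List A → ℤ
  lastExcursionCount x S = ∑ (perms S) (λ w → ∑ (cuts w) (λ (a , b) → lastExcursion ε a x b))

  -- After exchanging the words of each cut, the inner sum runs over the rotations of one cyclic
  -- word `x ∷ w`. The cycle lemma keeps one of them when the weight is zero, and there are |S|!
  -- words `w`.
  lastExcursionCount-cyclic : ∀ x S → lastExcursionCount x S ≡ cyclicCount (x ∷ S)
  lastExcursionCount-cyclic x S = begin
    ∑ (perms S) (λ w → ∑ (cuts w) (λ (a , b) → lastExcursion ε a x b))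
      ≡⟨ ∑-perms-cuts-swap S (λ a b → lastExcursion ε a x b) ⟩
    ∑ (perms S) (λ w → ∑ (cuts w) (λ (a , b) → lastExcursion ε b x a))
      ≡⟨ ∑-cong (perms S) (cycle-lemma x) ⟩
    ∑ (perms S) (λ w → isZero (weight (x ∷ w)))
      ≡⟨ ∑-congᴬ (All.map (λ p → cong isZero (weight-↭ (prep x p))) (perms-↭ S)) ⟩
    ∑ (perms S) (λ _ → isZero (weight (x ∷ S)))
      ≡⟨ ∑-perms-const S _ ⟩
    + (length S !) * isZero (weight (x ∷ S))
      ≡⟨ *-comm _ _ ⟩
    cyclicCount (x ∷ S) ∎

  -- The first excursion either contains `x`, and then is the whole walk, or uses a set `R` avoiding
  -- `x`. The term with empty `R` is 0 because `excursion []` is.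
  cyclicCount-recurrence : ∀ x S → cyclicCount (x ∷ S) ≡
    excursionCount (x ∷ S) + ∑ (choices S) (λ (R , B) → excursionCount R * cyclicCount (x ∷ B))
  cyclicCount-recurrence x S = begin
    cyclicCount (x ∷ S)
      ≡⟨ sym (lastExcursionCount-cyclic x S) ⟩
    ∑ (perms S) (λ w → ∑ (cuts w) (λ (a , b) → lastExcursion ε a x b))
      ≡⟨ ∑-cong (perms S) (λ w →
           trans (∑-cong (cuts w) (λ (a , b) → lastExcursion-excursion a x b)) (∑-+ (cuts w) _ _)) ⟩
    ∑ (perms S) (λ w →
      ∑ (cuts w) (λ (a , b) → excursion (a ++ x ∷ b)) +
      ∑ (cuts w) (λ (a , b) →
        ∑ (cuts a) (λ (a₁ , a₂) → excursion a₁ * lastExcursion ε a₂ x b)))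
      ≡⟨ ∑-+ (perms S) _ _ ⟩
    ∑ (perms S) (λ w → ∑ (cuts w) (λ (a , b) → excursion (a ++ x ∷ b))) +
    ∑ (perms S) (λ w → ∑ (cuts w) (λ (a , b) →
      ∑ (cuts a) (λ (a₁ , a₂) → excursion a₁ * lastExcursion ε a₂ x b)))
      ≡⟨ cong₂ _+_
           (trans (∑-cong (perms S) (λ w → sym (∑-insertAll x w excursion)))
                  (sym (∑-concatMap (insertAll x) (perms S) excursion)))
           -- Coassociativity makes the outer cut separate the first excursion from the rest of the
           -- walk, whose inner cut marks the place of `x`.
           (∑-cong (perms S) (λ w →
             trans (∑-cuts-coassoc w (λ a₁ a₂ b → excursion a₁ * lastExcursion ε a₂ x b))
                   (∑-cong (cuts w) (λ (a₁ , v) → ∑-*ˡ (excursion a₁) (cuts v) _)))) ⟩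
    excursionCount (x ∷ S) +
    ∑ (perms S) (λ w → ∑ (cuts w) (λ (a₁ , v) →
      excursion a₁ * ∑ (cuts v) (λ (a₂ , b) → lastExcursion ε a₂ x b)))
      ≡⟨ +-congˡ (∑-perms-cuts S _) ⟩
    excursionCount (x ∷ S) +
    ∑ (choices S) (λ (R , B) → ∑ (perms R) (λ u → ∑ (perms B) (λ v →
      excursion u * ∑ (cuts v) (λ (a , b) → lastExcursion ε a x b))))
      ≡⟨ +-congˡ (∑-cong (choices S) (λ (R , B) → product R B)) ⟩
    excursionCount (x ∷ S) + ∑ (choices S) (λ (R , B) → excursionCount R * cyclicCount (x ∷ B)) ∎
    where
    product : ∀ R B → ∑ (perms R) (λ u → ∑ (perms B) (λ v →
      excursion u * ∑ (cuts v) (λ (a , b) → lastExcursion ε a x b)))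
      ≡ excursionCount R * cyclicCount (x ∷ B)
    product R B = begin
      ∑ (perms R) (λ u → ∑ (perms B) (λ v →
        excursion u * ∑ (cuts v) (λ (a , b) → lastExcursion ε a x b)))
        ≡⟨ ∑-cong (perms R) (λ u → trans (∑-*ˡ (excursion u) (perms B) _)
             (trans (*-congˡ (lastExcursionCount-cyclic x B)) (*-comm _ _))) ⟩
      ∑ (perms R) (λ u → cyclicCount (x ∷ B) * excursion u)
        ≡⟨ ∑-*ˡ (cyclicCount (x ∷ B)) (perms R) excursion ⟩
      cyclicCount (x ∷ B) * excursionCount R
        ≡⟨ *-comm _ _ ⟩
      excursionCount R * cyclicCount (x ∷ B) ∎

  -- The exponential formula

  signedPartitionCount : List A → ℤ
  signedPartitionCount S = ∑ (setPartitions S) (blockProduct (λ b → -1ℤ * cyclicCount b))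

  opaque
    unfolding _+_ _*_

    solveFor : ∀ e f d → e + f ≡ d → e ≡ d + -1ℤ * f
    solveFor e f d eq = trans (lemma e f) (cong (_+ -1ℤ * f) eq)
      where
      lemma : ∀ e f → e ≡ (e + f) + -1ℤ * f
      lemma = solve-∀

    expand : ∀ c d f → (-1ℤ * c) * (d + -1ℤ * f) ≡ (-1ℤ * c) * d + f * c
    expand = solve-∀

    cancel : ∀ c f s → c ≡ f + s → (-1ℤ * c + s) + f ≡ 0ℤ
    cancel c f s refl = lemma f s
      where
      lemma : ∀ f s → (-1ℤ * (f + s) + s) + f ≡ 0ℤ
      lemma = solve-∀

  -- exp(-C) = 1 - F
  signedPartitionCount-excursionCount : ∀ n S → length S ≤ n →
    signedPartitionCount S + excursionCount S ≡ isEmpty S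
  signedPartitionCount-excursionCount n       []      _ =
    trans (+-congˡ (+-identityʳ _)) (trans (+-identityʳ _) (+-identityʳ _))
  -- The induction is on a bound for the length, since the complement `R` of a block is not a
  -- structural part of `x ∷ S`.
  signedPartitionCount-excursionCount (suc n) (x ∷ S) (s≤s S≤n) = begin
    signedPartitionCount (x ∷ S) + excursionCount (x ∷ S)
      ≡⟨ +-congʳ (∑-setPartitions-∷ _ x S) ⟩
    ∑ (choices S) (λ (B , R) → (-1ℤ * cyclicCount (x ∷ B)) * signedPartitionCount R) +
    excursionCount (x ∷ S)
      ≡⟨ +-congʳ (∑-congᴬ (All.map (λ {(B , R)} R≤S → trans
           (*-congˡ (solveFor _ _ _
             (signedPartitionCount-excursionCount n R (≤-trans R≤S S≤n))))
           (expand (cyclicCount (x ∷ B)) (isEmpty R) (excursionCount R))) (choices-length S))) ⟩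
    ∑ (choices S) (λ (B , R) →
      (-1ℤ * cyclicCount (x ∷ B)) * isEmpty R + excursionCount R * cyclicCount (x ∷ B)) +
    excursionCount (x ∷ S)
      -- The `isEmpty` terms leave only `B` = `S`, that is -C(x ∷ S). Exchanging the members of each
      -- choice turns the other terms into the sum of `cyclicCount-recurrence`.
      ≡⟨ +-congʳ (trans (∑-+ (choices S) _ _) (cong₂ _+_
           (∑-choices-isEmpty S (λ B → -1ℤ * cyclicCount (x ∷ B)))
           (∑-choices-swap S _))) ⟩
    (-1ℤ * cyclicCount (x ∷ S) +
     ∑ (choices S) (λ (R , B) → excursionCount R * cyclicCount (x ∷ B))) +
    excursionCount (x ∷ S)
      ≡⟨ cancel (cyclicCount (x ∷ S)) _ _ (cyclicCount-recurrence x S) ⟩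
    0ℤ ∎

  -- Translation to passport partitions and positive permutations

  allZero? : ∀ p → Dec (All (λ b → weight b ≡ ε) p)
  allZero? = all? (λ b → weight b ≟ ε)

  opaque
    unfolding _+_ _*_

    regroup : ∀ z c a s x → (-1ℤ * (z * c)) * (a * (s * x)) ≡ (z * a) * ((-1ℤ * s) * (c * x))
    regroup = solve-∀

    double-neg : ∀ a s x → a * (s * x) ≡ -1ℤ * (a * ((-1ℤ * s) * x))
    double-neg = solve-∀

  -- Each factor -C(b) carries one sign, one factorial and the test that the block has weight zero.
  blockProduct-cyclicCount : ∀ p → blockProduct (λ b → -1ℤ * cyclicCount b) p ≡
    ⟦ does (allZero? p) ⟧ * (signℤ (length p) * + X p)
  blockProduct-cyclicCount []      = sym (trans (*-identityˡ _) (*-identityˡ _))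
  blockProduct-cyclicCount (b ∷ p) = begin
    (-1ℤ * (isZero (weight b) * + ((length b ∸ 1) !))) *
    blockProduct (λ b → -1ℤ * cyclicCount b) p
      ≡⟨ *-congˡ (blockProduct-cyclicCount p) ⟩
    (-1ℤ * (isZero (weight b) * + ((length b ∸ 1) !))) *
    (⟦ does (allZero? p) ⟧ * (signℤ (length p) * + X p))
      ≡⟨ regroup (isZero (weight b)) _ _ _ _ ⟩
    (isZero (weight b) * ⟦ does (allZero? p) ⟧) *
    ((-1ℤ * signℤ (length p)) * (+ ((length b ∸ 1) !) * + X p))
      ≡⟨ cong₂ _*_ (sym (⟦⟧-∧ (does (weight b ≟ ε)) _))
           (cong₂ _*_ (sym (signℤ-suc (length p))) (sym (pos-* ((length b ∸ 1) !) (X p)))) ⟩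
    ⟦ does (allZero? (b ∷ p)) ⟧ * (signℤ (length (b ∷ p)) * + X (b ∷ p)) ∎

  -- The factor -1 comes from the exponent `length p ∸ 1` in place of `length p`. The subtraction is
  -- not truncated, as partitions of a nonempty set have a block.
  alternatingSum-signedPartitionCount : ∀ x S →
    alternatingSum (filter allZero? (setPartitions (x ∷ S))) ≡ -1ℤ * signedPartitionCount (x ∷ S)
  alternatingSum-signedPartitionCount x S = begin
    alternatingSum (filter allZero? (setPartitions (x ∷ S)))
      ≡⟨ alternatingSum-∑ (filter allZero? (setPartitions (x ∷ S))) ⟩
    ∑ (filter allZero? (setPartitions (x ∷ S))) (λ p → signℤ (length p ∸ 1) * + X p)
      ≡⟨ ∑-filter allZero? (setPartitions (x ∷ S)) _ ⟩
    ∑ (setPartitions (x ∷ S)) (λ p →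
      ⟦ does (allZero? p) ⟧ * (signℤ (length p ∸ 1) * + X p))
      ≡⟨ ∑-congᴬ (All.map (λ {p} → term p) (setPartitions-nonempty x S)) ⟩
    ∑ (setPartitions (x ∷ S)) (λ p → -1ℤ * blockProduct (λ b → -1ℤ * cyclicCount b) p)
      ≡⟨ ∑-*ˡ -1ℤ (setPartitions (x ∷ S)) _ ⟩
    -1ℤ * signedPartitionCount (x ∷ S) ∎
    where
    term : ∀ p → p ≢ [] → ⟦ does (allZero? p) ⟧ * (signℤ (length p ∸ 1) * + X p) ≡
                          -1ℤ * blockProduct (λ b → -1ℤ * cyclicCount b) p
    term []      p≢[] = ⊥-elim (p≢[] refl)
    term (b ∷ p) _    = trans (double-neg _ _ _) (cong (-1ℤ *_)
      (trans (cong (λ s → ⟦ does (allZero? (b ∷ p)) ⟧ * (s * + X (b ∷ p)))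
                   (sym (signℤ-suc (length p))))
             (sym (blockProduct-cyclicCount (b ∷ p)))))

  -- `take` drops exactly the last of the `suc (length w)` heights. That one is `ε` by hypothesis,
  -- so the final `isZero` test in `descent` succeeds.
  descent-positive : ∀ c w → c ∙ weight w ≡ ε →
    ⟦ does (all? (ε <?_) (take (length w) (c ∷ prefixSums c (map wt w)))) ⟧ ≡ descent c w
  descent-positive c []      e = sym (⟦⟧-yes (c ≟ ε) (trans (sym (∙-identityʳ c)) e))
  descent-positive c (y ∷ w) e = trans (⟦⟧-∧ (does (ε <? c)) _)
    (cong (isPos c *_) (descent-positive (c ∙ wt y) w (trans (∙-assoc _ _ _) e)))

  excursion-positive : ∀ n σ → length σ ≡ suc n → weight σ ≡ ε →
    ⟦ does (all? (ε <?_) (take n (prefixSums ε (map wt σ)))) ⟧ ≡ excursion σ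
  excursion-positive _ (y ∷ w) refl e = begin
    ⟦ does (all? (ε <?_) (take (length w) (prefixSums ε (map wt (y ∷ w))))) ⟧
      ≡⟨ cong (λ c → ⟦ does (all? (ε <?_) (take (length w) (c ∷ prefixSums c (map wt w)))) ⟧)
           (∙-identityˡ (wt y)) ⟩
    ⟦ does (all? (ε <?_) (take (length w) (wt y ∷ prefixSums (wt y) (map wt w)))) ⟧
      ≡⟨ descent-positive (wt y) w e ⟩
    excursion (y ∷ w) ∎

theorem3p8 : (G : OrderedAbelianGroup) (N : ℕ) → 2 ≤ N →
    (wt : Fin N → OrderedAbelianGroup.Carrier G) →
    (∀ s → wt s ≢ OrderedAbelianGroup.ε G) →
    OrderedAbelianGroup.sumG G (map wt (allFin N)) ≡ OrderedAbelianGroup.ε G →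
    + numPositivePerms G wt ≡ alternatingSum (passportPartitions G wt)
theorem3p8 G (suc n) _ wt _ total = begin
  + length (filter (isPositive? G wt) (perms S))
    ≡⟨ length-∑ (filter (isPositive? G wt) (perms S)) ⟩
  ∑ (filter (isPositive? G wt) (perms S)) (λ _ → 1ℤ)
    ≡⟨ ∑-filter (isPositive? G wt) (perms S) _ ⟩
  ∑ (perms S) (λ σ → ⟦ does (isPositive? G wt σ) ⟧ * 1ℤ)
    ≡⟨ ∑-congᴬ (All.map (λ {σ} p → trans (*-identityʳ _)
         (excursion-positive n σ (trans (↭-length p) (length-tabulate id))
                                 (trans (weight-↭ p) total)))
         (perms-↭ S)) ⟩
  excursionCount S
    -- `isEmpty` vanishes on the nonempty `S`, so E(S) + F(S) = 0 is solved for F(S).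
    ≡⟨ solveFor _ _ _ (trans (+-comm (excursionCount S) (signedPartitionCount S))
         (signedPartitionCount-excursionCount (length S) S ≤-refl)) ⟩
  0ℤ + -1ℤ * signedPartitionCount S
    ≡⟨ +-identityˡ _ ⟩
  -1ℤ * signedPartitionCount S
    ≡⟨ sym (alternatingSum-signedPartitionCount zero (tabulate suc)) ⟩
  alternatingSum (passportPartitions G wt) ∎
  where
  open Walks G wt
  S = allFin (suc n)
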